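{- There exists an infinite word over a 3-letter alphabet that simultaneously avoids the two formulas with reversal $xyzx\cdot yzxy\cdot z^R$ and $xyzx\cdot yz^Rxy$.
   Context: A formula with reversal is a finite set of words (called fragments, written separated by dots) over an alphabet of variables, where each variable $x$ may occur either as $x$ or as $x^R$. An occurrence of a formula with reversal $F$ in a word $w$ is a map $h$ assigning to each variable a nonempty word, extended to fragments by concatenation with the convention $h(x^R)=h(x)^R$ (the reverse, i.e. mirror image, of $h(x)$), such that $h(f)$ is a factor of $w$ for every fragment $f$ of $F$. A word avoids $F$ if it contains no occurrence of $F$. -}

module Defs where

open import Data.Nat using (ℕ; _+_; _<_)
open import Data.Fin using (Fin; zero; suc)
open import Data.Bool using (Bool; true; false)
open import Data.List using (List; []; _∷_; length; reverse; concatMap; lookup)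
open import Data.List.Relation.Unary.All using (All)
open import Data.Product using (Σ; ∃; _×_; _,_)
open import Relation.Binary.PropositionalEquality using (_≡_; _≢_)
open import Relation.Nullary using (¬_)

InfWord : Set → Set
InfWord A = ℕ → A

Factor : {A : Set} → List A → InfWord A → Set
Factor u w = ∃ λ i → (j : Fin (length u)) → w (i + Data.Fin.toℕ j) ≡ lookup u j

record VarOcc (k : ℕ) : Set where
  constructor occ
  field
    var      : Fin k
    reversed : Bool

Fragment : ℕ → Set
Fragment k = List (VarOcc k)

Formula : ℕ → Set
Formula k = List (Fragment k)

imageOcc : {A : Set} {k : ℕ} → (Fin k → List A) → VarOcc k → List A
imageOcc h (occ v false) = h v
imageOcc h (occ v true)  = reverse (h v)

image : {A : Set} {k : ℕ} → (Fin k → List A) → Fragment k → List A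
image h f = concatMap (imageOcc h) f

Occurrence : {A : Set} {k : ℕ} → Formula k → InfWord A → Set
Occurrence {A} {k} F w =
  Σ (Fin k → List A) λ h →
    ((v : Fin k) → h v ≢ []) × All (λ f → Factor (image h f) w) F

Avoids : {A : Set} {k : ℕ} → InfWord A → Formula k → Set
Avoids w F = ¬ Occurrence F w

x y z : VarOcc 3
x = occ zero false
y = occ (suc zero) false
z = occ (suc (suc zero)) false

zR : VarOcc 3
zR = occ (suc (suc zero)) true

F₁ : Formula 3
F₁ = (x ∷ y ∷ z ∷ x ∷ []) ∷ (y ∷ z ∷ x ∷ y ∷ []) ∷ (zR ∷ []) ∷ []

F₂ : Formula 3
F₂ = (x ∷ y ∷ z ∷ x ∷ []) ∷ (y ∷ zR ∷ x ∷ y ∷ []) ∷ []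

{-# OPTIONS --safe #-}
module Submission where

-- Let u be the fixed point of the 8-uniform morphism f over six letters and w = g(u) for a
-- 46-uniform g into three letters.  Long enough factors of f(u) and g(u) determine their
-- position modulo the block length, so a long repetition comes from one in u whose period is
-- shorter by the factor 8 or 46.  With a finite check of the short repetitions this gives: if
-- m letters of u recur at distance d > 0 then 2m < d, and if m ≥ 7 letters of w recur at
-- distance d > 0 then 2m + 3 < d.
-- No factor of length 4 of w has its reversal in w, so |z| ≤ 3 in any occurrence of either
-- formula.  The longer of x and y recurs after a gap of length at most its own length plus 3
-- (x in xyzx, y in yzxy or yzᴿxy), so it has length at most 6, and finitely many cases remain.

open import Defs
open import Data.Bool using (Bool; T; true; false; _∧_; _∨_; not; if_then_else_)
open import Data.Bool.Properties using (∨-zeroʳ)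
open import Data.Bool.ListAction using (all)
open import Data.Empty using (⊥)
open import Data.Fin using (Fin; zero; suc; toℕ)
open import Data.Fin.Properties using (toℕ-injective) renaming (_≟_ to _≟ᶠ_)
open import Data.List using (List; []; _∷_; _++_; allFin; concatMap; drop; foldr; length; lookup; map; reverse; take; upTo)
import Data.List.Membership.DecPropositional as DecMembership
open import Data.List.Membership.Propositional using (_∈_)
open import Data.List.Membership.Propositional.Properties using (∈-map⁺; ∈-upTo⁺)
open import Data.List.Properties using (++-assoc; ++-identityʳ; ∷-injective; ≡-dec; length-++; length-reverse; reverse-++)
open import Data.List.Relation.Unary.All using ([]; _∷_)
open import Data.List.Relation.Unary.Any using (here; there)
open import Data.Nat using (ℕ; zero; suc; _+_; _*_; _∸_; _⊔_; _≤_; _<_; _≡ᵇ_; _<ᵇ_; z≤n; s≤s; NonZero; >-nonZero)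
open import Data.Nat.DivMod using (_/_; _%_; _mod_; m≡m%n+[m/n]*n; m%n<n; [m+kn]%n≡m%n; m*n/n≡m; m/n*n≤m; m/n<m; m<n⇒m/n≡0; m<n⇒m%n≡m; m<n*o⇒m/o<n; +-distrib-/-∣ˡ; +-distrib-/-∣ʳ; /-monoˡ-≤)
open import Data.Nat.Divisibility using (n∣m*n)
open import Data.Nat.Induction using (<-rec)
open import Data.Nat.Properties
open import Data.Nat.Solver using (module +-*-Solver)
open import Data.Product using (Σ; ∃; _×_; _,_; proj₁; proj₂)
open import Data.Sum using (inj₁; inj₂)
open import Data.Vec as Vec using (Vec)
open import Relation.Binary.PropositionalEquality
open import Relation.Nullary using (Dec; yes; no; does; contradiction)

open +-*-Solver using (solve; _:+_; _:*_; _:=_; con)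

private variable
  A : Set
  n : ℕ

-- Boolean tests and tries.

allBelow : ℕ → (ℕ → Bool) → Bool
allBelow zero    p = true
allBelow (suc n) p = p n ∧ allBelow n p

comparable : List (Fin n) → List (Fin n) → Bool
comparable (a ∷ as) (b ∷ bs) = (toℕ a ≡ᵇ toℕ b) ∧ comparable as bs
comparable _        _        = true

nth : List (Fin (suc n)) → ℕ → Fin (suc n)
-- A default for totality; the positions read below stay inside the list.
nth []       _       = zero
nth (a ∷ _)  zero    = a
nth (_ ∷ as) (suc i) = nth as i

-- The boolean tests below are evaluated by the type checker; tries make dictionary lookup cheap
-- enough, and nothing needs to be proved about insert, since every lookup is checked.
data Trie (n : ℕ) : Set where
  leaf : Trie n
  node : ℕ → Vec (Trie n) n → Trie n

insert : List (Fin n) → ℕ → Trie n → Trie n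
insert []       v leaf        = node v (Vec.replicate _ leaf)
insert []       v (node _ ts) = node v ts
insert (a ∷ as) v leaf        = node 0 (Vec.updateAt (Vec.replicate _ leaf) a (insert as v))
insert (a ∷ as) v (node o ts) = node o (Vec.updateAt ts a (insert as v))

subtrie : List (Fin n) → Trie n → Trie n
subtrie []       t           = t
subtrie (a ∷ as) leaf        = leaf
subtrie (a ∷ as) (node _ ts) = subtrie as (Vec.lookup ts a)

value : Trie n → ℕ
value leaf       = 0
value (node v _) = v

nonempty : Trie n → Bool
nonempty leaf       = false
nonempty (node _ _) = true

∧-true : ∀ {p q} → p ∧ q ≡ true → p ≡ true × q ≡ true
∧-true {true} {true} _ = refl , refl

not-true : ∀ {p} → not p ≡ true → p ≡ true → ⊥
not-true {true} () _

≡ᵇ-true : ∀ m n → (m ≡ᵇ n) ≡ true → m ≡ n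
≡ᵇ-true m n e = ≡ᵇ⇒≡ m n (subst T (sym e) _)

≡ᵇ-refl : ∀ m → (m ≡ᵇ m) ≡ true
≡ᵇ-refl zero    = refl
≡ᵇ-refl (suc m) = ≡ᵇ-refl m

all-sound : (p : A → Bool) {xs : List A} → all p xs ≡ true → ∀ {a} → a ∈ xs → p a ≡ true
all-sound p e (here refl) = proj₁ (∧-true e)
all-sound p e (there i)   = all-sound p (proj₂ (∧-true e)) i

allBelow-sound : (p : ℕ → Bool) → ∀ {m} → allBelow m p ≡ true → ∀ {i} → i < m → p i ≡ true
allBelow-sound p {suc m} e {i} (s≤s i≤m) with m≤n⇒m<n∨m≡n i≤m
... | inj₁ i<m  = allBelow-sound p (proj₂ (∧-true e)) i<m
... | inj₂ refl = proj₁ (∧-true e)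

dec-sound : (d : Dec A) → does d ≡ true → A
dec-sound (yes a) _ = a

comparable-++ : (as bs : List (Fin n)) → comparable as (as ++ bs) ≡ true
comparable-++ []       bs = refl
comparable-++ (a ∷ as) bs rewrite ≡ᵇ-refl (toℕ a) = comparable-++ as bs

-- Every prefix of a path in a trie is a path, so a dictionary of words of one length also
-- recognises their shorter prefixes.
nonempty-++ : (as bs : List (Fin n)) (t : Trie n) →
  nonempty (subtrie (as ++ bs) t) ≡ true → nonempty (subtrie as t) ≡ true
nonempty-++ []       []       t           e = e
nonempty-++ []       (b ∷ bs) (node _ _)  e = refl
nonempty-++ (a ∷ as) bs       (node _ ts) e = nonempty-++ as bs (Vec.lookup ts a) e

+-≤⇒≤-∸ : ∀ t {m n} → t + m ≤ n → m ≤ n ∸ t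
+-≤⇒≤-∸ t {m} {n} le = m+n≤o⇒m≤o∸n m (subst (_≤ n) (+-comm t m) le)

-- Windows of infinite words.

win : (ℕ → A) → ℕ → ℕ → List A
win w i zero    = []
win w i (suc n) = w i ∷ win w (suc i) n

win-+ : ∀ (w : ℕ → A) i m n → win w i (m + n) ≡ win w i m ++ win w (i + m) n
win-+ w i zero    n = cong (λ j → win w j n) (sym (+-identityʳ i))
win-+ w i (suc m) n = cong (w i ∷_) (trans (win-+ w (suc i) m n) (cong (λ j → win w (suc i) m ++ win w j n) (sym (+-suc i m))))

take-win : ∀ (w : ℕ → A) i {m n} → m ≤ n → take m (win w i n) ≡ win w i m
take-win w i z≤n       = refl
take-win w i (s≤s m≤n) = cong (w i ∷_) (take-win w (suc i) m≤n)

drop-win : ∀ (w : ℕ → A) i m n → drop m (win w i n) ≡ win w (i + m) (n ∸ m)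
drop-win w i zero    n       = cong (λ j → win w j n) (sym (+-identityʳ i))
drop-win w i (suc m) zero    = refl
drop-win w i (suc m) (suc n) = trans (drop-win w (suc i) m n) (cong (λ j → win w j (n ∸ m)) (sym (+-suc i m)))

take-drop-win : ∀ (w : ℕ → A) i {t m n} → t + m ≤ n → take m (drop t (win w i n)) ≡ win w (i + t) m
take-drop-win w i {t} {m} {n} le = trans (cong (take m) (drop-win w i t n)) (take-win w (i + t) (+-≤⇒≤-∸ t le))

subwindow : ∀ (w : ℕ → A) {i j m} t {n} → t + n ≤ m → win w i m ≡ win w j m → win w (i + t) n ≡ win w (j + t) n
subwindow w {i} {j} t {n} le e = trans (sym (take-drop-win w i le)) (trans (cong (λ s → take n (drop t s)) e) (take-drop-win w j le))

win-ext : ∀ (w w′ : ℕ → A) i j m → (∀ t → t < m → w (i + t) ≡ w′ (j + t)) → win w i m ≡ win w′ j m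
win-ext w w′ i j zero    e = refl
win-ext w w′ i j (suc m) e = cong₂ _∷_ (subst₂ (λ p q → w p ≡ w′ q) (+-identityʳ i) (+-identityʳ j) (e 0 (s≤s z≤n)))
  (win-ext w w′ (suc i) (suc j) m (λ t t<m → subst₂ (λ p q → w p ≡ w′ q) (+-suc i t) (+-suc j t) (e (suc t) (s≤s t<m))))

win-list : ∀ (w : ℕ → Fin (suc n)) i as → (∀ t → t < length as → w (i + t) ≡ nth as t) → win w i (length as) ≡ as
win-list w i []       e = refl
win-list w i (a ∷ as) e = cong₂ _∷_ (subst (λ p → w p ≡ a) (+-identityʳ i) (e 0 (s≤s z≤n)))
  (win-list w (suc i) as (λ t t<m → subst (λ p → w p ≡ nth as t) (+-suc i t) (e (suc t) (s≤s t<m))))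

nth-win : ∀ (w : ℕ → Fin (suc n)) i {t m} → t < m → nth (win w i m) t ≡ w (i + t)
nth-win w i {zero}  (s≤s _)   = cong w (sym (+-identityʳ i))
nth-win w i {suc t} (s≤s t<m) = trans (nth-win w (suc i) t<m) (cong w (sym (+-suc i t)))

-- Uniform morphisms: finite tests and desubstitution.

blocks-of-letters : ∀ {a b} (k : ℕ) .{{_ : NonZero k}} (φ : Fin a → List (Fin (suc b))) (v : ℕ → Fin a) (V : ℕ → Fin (suc b)) →
  (∀ c → length (φ c) ≡ k) → (∀ i → V i ≡ nth (φ (v (i / k))) (i % k)) → ∀ n → win V (n * k) k ≡ φ (v n)
blocks-of-letters k φ v V len letter n = subst (λ l → win V (n * k) l ≡ φ (v n)) (len (v n))
  (win-list V (n * k) (φ (v n)) λ t t<l → let t<k = subst (t <_) (len (v n)) t<l in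
    trans (letter (n * k + t)) (cong₂ (λ p q → nth (φ (v p)) q) (quotient t t<k) (remainder t t<k)))
  where
  quotient : ∀ t → t < k → (n * k + t) / k ≡ n
  quotient t t<k = trans (+-distrib-/-∣ˡ t (n∣m*n n)) (trans (cong₂ _+_ (m*n/n≡m n k) (m<n⇒m/n≡0 t<k)) (+-identityʳ n))
  remainder : ∀ t → t < k → (n * k + t) % k ≡ t
  remainder t t<k = trans (cong (_% k) (+-comm (n * k) t)) (trans ([m+kn]%n≡m%n t n k) (m<n⇒m%n≡m t<k))

module Uniform {a b : ℕ} (k : ℕ) .{{_ : NonZero k}} (φ : Fin (suc a) → List (Fin b))
  (triples : List (List (Fin (suc a)))) where

  -- A test sees an offset o < k, three consecutive letters of the preimage, and the window of
  -- length 2k + 1 that starts o letters into their image.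
  Test : Set
  Test = ℕ → List (Fin (suc a)) → List (Fin b) → Bool

  scanBlock : Test → List (Fin (suc a)) → List (Fin b) → Bool
  scanBlock Q t s = allBelow k (λ o → Q o t (take (suc (k + k)) (drop o s)))

  scan : Test → Bool
  scan Q = all (λ t → scanBlock Q t (concatMap φ t)) triples

  -- Each factor is stored with the offset at which it starts. A factor with two offsets keeps only
  -- one of them, and `syncTest` then fails at the other.
  dictionary : ℕ → Trie b
  dictionary L = foldr (λ t → insertAll (concatMap φ t)) leaf triples
    where
    insertAll : List (Fin b) → Trie b → Trie b
    insertAll s T = foldr (λ o → insert (take L (drop o s)) o) T (upTo k)

  syncTest : Trie b → ℕ → Test
  syncTest T L o _ s = value (subtrie (take L s) T) ≡ᵇ o

  -- The letter whose block contains the h-th letter of a window s read at offset o; the tail of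
  -- the first block is compared with s if it reaches that far, and the second block otherwise.
  letterAt : ℕ → ℕ → List (Fin b) → Fin (suc a)
  letterAt h o s = pick fits (allFin (suc a))
    where
    fits : Fin (suc a) → Bool
    fits c = if o + h <ᵇ k then comparable (drop o (φ c)) s else comparable (φ c) (drop (k ∸ o) s)
    pick : (Fin (suc a) → Bool) → List (Fin (suc a)) → Fin (suc a)
    pick p []       = zero
    pick p (c ∷ cs) = if p c then c else pick p cs

  decodeTest : ℕ → ℕ → Test
  decodeTest h E o t s = toℕ (letterAt h o (take E s)) ≡ᵇ toℕ (nth t ((o + h) / k))

  apart : List (Fin b) → ℕ × ℕ → Bool
  apart s (d , m) = not (comparable (take m s) (drop d s))

  repetitionTest : List (ℕ × ℕ) → Test
  repetitionTest ps _ _ s = all (apart s) ps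

  syncs : Trie b → ℕ → Bool
  syncs T L = scan (syncTest T L)

  decodes : ℕ → ℕ → Bool
  decodes h E = scan (decodeTest h E)

  -- Between windows at distance d ≤ D, no coincidence of length need d.
  repetitionFree : ℕ → (ℕ → ℕ) → Bool
  repetitionFree D need = scan (repetitionTest (map (λ d → suc d , need (suc d)) (upTo D)))

  module Image (v : ℕ → Fin (suc a)) (V : ℕ → Fin b) (blocks : ∀ n → win V (n * k) k ≡ φ (v n)) where

    win-image : ∀ n m → win V (n * k) (m * k) ≡ concatMap φ (win v n m)
    win-image n zero    = refl
    win-image n (suc m) = trans (win-+ V (n * k) k (m * k))
      (cong₂ _++_ (blocks n) (trans (cong (λ j → win V j (m * k)) (+-comm (n * k) k)) (win-image (suc n) m)))

    divMod : ∀ i → i / k * k + i % k ≡ i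
    divMod i = trans (+-comm (i / k * k) (i % k)) (sym (m≡m%n+[m/n]*n i k))

    -- The offset is at most `k - 1` and `(k - 1) + (2k + 1) = 3k`, so three blocks always contain
    -- the window.
    win-triple : ∀ i {r} → r ≤ suc (k + k) → take r (drop (i % k) (concatMap φ (win v (i / k) 3))) ≡ win V i r
    win-triple i {r} r≤ = trans (cong (λ s → take r (drop (i % k) s)) (sym (win-image (i / k) 3)))
      (trans (take-drop-win V (i / k * k) fits) (cong (λ j → win V j r) (divMod i)))
      where
      fits : i % k + r ≤ 3 * k
      fits = begin
        i % k + r           ≤⟨ +-monoʳ-≤ (i % k) r≤ ⟩
        i % k + suc (k + k) ≡⟨ +-suc (i % k) (k + k) ⟩
        suc (i % k) + (k + k) ≤⟨ +-monoˡ-≤ (k + k) (m%n<n i k) ⟩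
        k + (k + k)         ≡⟨ cong (λ j → k + (k + j)) (sym (+-identityʳ k)) ⟩
        3 * k               ∎
        where open ≤-Reasoning

    -- Membership is assumed only for the triple at hand, so this can be used while completeness of
    -- the list is still being proved by induction.
    scan-sound-at : ∀ Q → scan Q ≡ true → ∀ i → win v (i / k) 3 ∈ triples →
      Q (i % k) (win v (i / k) 3) (win V i (suc (k + k))) ≡ true
    scan-sound-at Q e i t∈ = subst (λ s → Q (i % k) (win v (i / k) 3) s ≡ true) (win-triple i ≤-refl)
      (allBelow-sound _ (all-sound (λ t → scanBlock Q t (concatMap φ t)) e t∈) (m%n<n i k))

    module Complete (complete : ∀ n → win v n 3 ∈ triples) where

      scan-sound : ∀ Q → scan Q ≡ true → ∀ i → Q (i % k) (win v (i / k) 3) (win V i (suc (k + k))) ≡ true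
      scan-sound Q e i = scan-sound-at Q e i (complete (i / k))

      -- The trie computes the offset from the window alone, so equal windows have equal offsets.
      syncs-sound : ∀ T {L} → syncs T L ≡ true → L ≤ suc (k + k) → ∀ {i j} → win V i L ≡ win V j L → i % k ≡ j % k
      syncs-sound T {L} e L≤ {i} {j} eq = trans (sym (code i)) (trans (cong (λ s → value (subtrie s T)) eq) (code j))
        where
        code : ∀ i → value (subtrie (win V i L) T) ≡ i % k
        code i = subst (λ s → value (subtrie s T) ≡ i % k) (take-win V i L≤) (≡ᵇ-true _ _ (scan-sound (syncTest T L) e i))

      decodes-sound : ∀ {h E} → decodes h E ≡ true → E ≤ suc (k + k) → h ≤ k → ∀ i →
        letterAt h (i % k) (win V i E) ≡ v ((i + h) / k)
      decodes-sound {h} {E} e E≤ h≤k i = trans (cong (letterAt h (i % k)) (sym (take-win V i E≤)))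
        (trans (toℕ-injective (≡ᵇ-true _ _ (scan-sound (decodeTest h E) e i))) (trans (nth-win v (i / k) small) (cong v shift)))
        where
        small : (i % k + h) / k < 3
        small = m<n*o⇒m/o<n (<-≤-trans (+-mono-<-≤ (m%n<n i k) h≤k) (+-monoʳ-≤ k (m≤m+n k (k + 0))))
        shift : i / k + (i % k + h) / k ≡ (i + h) / k
        shift = begin
          i / k + (i % k + h) / k         ≡⟨ cong (_+ (i % k + h) / k) (sym (m*n/n≡m (i / k) k)) ⟩
          i / k * k / k + (i % k + h) / k ≡⟨ sym (+-distrib-/-∣ˡ (i % k + h) (n∣m*n (i / k))) ⟩
          (i / k * k + (i % k + h)) / k   ≡⟨ cong (_/ k) (sym (+-assoc (i / k * k) (i % k) h)) ⟩
          (i / k * k + i % k + h) / k     ≡⟨ cong (λ j → (j + h) / k) (divMod i) ⟩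
          (i + h) / k                     ∎
          where open ≡-Reasoning

      -- Cut down to `need` letters, the repetition would fit in one window and make the two lists
      -- compared by `apart` agree.
      repetitionFree-sound : ∀ D need → repetitionFree D need ≡ true → ∀ {i d m} → d < D → need (suc d) ≤ m →
        suc d + m ≤ suc (k + k) → win V i m ≡ win V (i + suc d) m → ⊥
      repetitionFree-sound D need e {i} {d} {m} d<D n≤m fits eq =
        not-true
          (all-sound (apart (win V i (suc (k + k))))
            (scan-sound (repetitionTest (map (λ d → suc d , need (suc d)) (upTo D))) e i)
            (∈-map⁺ (λ d → suc d , need (suc d)) (∈-upTo⁺ d<D)))
          (trans (cong₂ comparable prefix suffix) (comparable-++ (win V (i + suc d) l) _))
        where
        R l r : ℕ
        R = suc (k + k)
        l = need (suc d)
        r = R ∸ suc d ∸ l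
        eqₗ : win V i l ≡ win V (i + suc d) l
        eqₗ = trans (sym (take-win V i n≤m)) (trans (cong (take l) eq) (take-win V (i + suc d) n≤m))
        prefix : take l (win V i R) ≡ win V (i + suc d) l
        prefix = trans (take-win V i (≤-trans n≤m (≤-trans (m≤n+m m (suc d)) fits))) eqₗ
        suffix : drop (suc d) (win V i R) ≡ win V (i + suc d) l ++ win V (i + suc d + l) r
        suffix = trans (drop-win V i (suc d) R)
          (trans (cong (win V (i + suc d)) (sym (m+[n∸m]≡n (≤-trans n≤m (+-≤⇒≤-∸ (suc d) fits)))))
                 (win-+ V (i + suc d) l r))

      -- A repetition of length m at distance d in V comes from one in v: after synchronisation d is
      -- a multiple of k, and every length-E window inside it decodes the letter at its h-th place,
      -- so all blocks meeting m - E + 1 consecutive places are recovered.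
      record Desubstituted (d m E : ℕ) : Set where
        field
          {position distance size} : ℕ
          d≡        : d ≡ distance * k
          size>0    : 0 < size
          m<        : m < size * k + E
          agreement : win v position size ≡ win v (position + distance) size

      desubstitute : ∀ T L h E → syncs T L ≡ true → decodes h E ≡ true →
        L ≤ suc (k + k) → E ≤ suc (k + k) → h ≤ k →
        ∀ {i d m} → L ≤ m → E ≤ m → win V i m ≡ win V (i + d) m → Desubstituted d m E
      desubstitute T L h E sy de L≤ E≤ h≤k {i} {d} {m} L≤m E≤m eq = record
        { d≡ = d≡; size>0 = s≤s z≤n; m< = bound; agreement = win-ext v v a′ (a′ + d′) (suc (b′ ∸ a′)) agree }
        where
        mods : i % k ≡ (i + d) % k
        mods = syncs-sound T sy L≤ (trans (sym (take-win V i L≤m)) (trans (cong (take L) eq) (take-win V (i + d) L≤m)))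
        -- `a′` and `b′` are the blocks of the first and the last decoded position, `i + h` and
        -- `i + h + (m ∸ E)`.
        d′ a′ b′ : ℕ
        d′ = (i + d) / k ∸ i / k
        a′ = (i + h) / k
        b′ = (i + h + (m ∸ E)) / k
        quotients : (i + d) / k * k ≡ i / k * k + d
        quotients = +-cancelˡ-≡ (i % k) _ _ (begin
          i % k + (i + d) / k * k       ≡⟨ cong (_+ (i + d) / k * k) mods ⟩
          (i + d) % k + (i + d) / k * k ≡⟨ sym (m≡m%n+[m/n]*n (i + d) k) ⟩
          i + d                         ≡⟨ cong (_+ d) (m≡m%n+[m/n]*n i k) ⟩
          i % k + i / k * k + d         ≡⟨ +-assoc (i % k) (i / k * k) d ⟩
          i % k + (i / k * k + d)       ∎)
          where open ≡-Reasoning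
        d≡ : d ≡ d′ * k
        d≡ = sym (trans (*-distribʳ-∸ k ((i + d) / k) (i / k)) (trans (cong (_∸ i / k * k) quotients) (m+n∸m≡n (i / k * k) d)))
        a′≤b′ : a′ ≤ b′
        a′≤b′ = /-monoˡ-≤ k (m≤m+n (i + h) (m ∸ E))
        <-block : ∀ j → j < suc (j / k) * k
        <-block j = subst (_< suc (j / k) * k) (sym (m≡m%n+[m/n]*n j k)) (+-monoˡ-< (j / k * k) (m%n<n j k))
        -- All decoded positions lie in blocks `a′` to `b′`, so `m ∸ E` is less than the total
        -- length of these blocks.
        bound : m < suc (b′ ∸ a′) * k + E
        bound = subst (_< suc (b′ ∸ a′) * k + E) (m∸n+n≡m E≤m) (+-monoˡ-< E (+-cancelˡ-< (a′ * k) _ _ (begin-strict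
          a′ * k + (m ∸ E)              ≤⟨ +-monoˡ-≤ (m ∸ E) (m/n*n≤m (i + h) k) ⟩
          i + h + (m ∸ E)               <⟨ <-block (i + h + (m ∸ E)) ⟩
          suc b′ * k                    ≡⟨ cong (λ j → suc j * k) (sym (m+[n∸m]≡n a′≤b′)) ⟩
          suc (a′ + (b′ ∸ a′)) * k      ≡⟨ cong (_* k) (sym (+-suc a′ (b′ ∸ a′))) ⟩
          (a′ + suc (b′ ∸ a′)) * k      ≡⟨ *-distribʳ-+ k a′ (suc (b′ ∸ a′)) ⟩
          a′ * k + suc (b′ ∸ a′) * k    ∎)))
          where open ≤-Reasoning
        at : ∀ t → t ≤ m ∸ E → v ((i + h + t) / k) ≡ v ((i + h + t) / k + d′)
        at t t≤ = begin
          v ((i + h + t) / k)                            ≡⟨ cong (λ j → v (j / k)) (swap i) ⟩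
          v ((i + t + h) / k)                            ≡⟨ sym (decodes-sound de E≤ h≤k (i + t)) ⟩
          letterAt h ((i + t) % k) (win V (i + t) E)     ≡⟨ cong₂ (letterAt h) sameMod (subwindow V t (m≤o∸n⇒m+n≤o t E≤m t≤) eq) ⟩
          letterAt h ((i + d + t) % k) (win V (i + d + t) E) ≡⟨ decodes-sound de E≤ h≤k (i + d + t) ⟩
          v ((i + d + t + h) / k)                        ≡⟨ cong (λ j → v (j / k)) rearrange ⟩
          v ((i + h + t + d′ * k) / k)                   ≡⟨ cong v (+-distrib-/-∣ʳ (i + h + t) (n∣m*n d′)) ⟩
          v ((i + h + t) / k + d′ * k / k)               ≡⟨ cong (λ j → v ((i + h + t) / k + j)) (m*n/n≡m d′ k) ⟩
          v ((i + h + t) / k + d′)                       ∎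
          where
          open ≡-Reasoning
          swap : ∀ i → i + h + t ≡ i + t + h
          swap i = trans (+-assoc i h t) (trans (cong (i +_) (+-comm h t)) (sym (+-assoc i t h)))
          moved : i + d + t ≡ i + t + d′ * k
          moved = trans (+-assoc i d t) (trans (cong (i +_) (trans (+-comm d t) (cong (t +_) d≡))) (sym (+-assoc i t (d′ * k))))
          sameMod : (i + t) % k ≡ (i + d + t) % k
          sameMod = sym (trans (cong (_% k) moved) ([m+kn]%n≡m%n (i + t) d′ k))
          rearrange : i + d + t + h ≡ i + h + t + d′ * k
          rearrange = begin
            i + d + t + h        ≡⟨ cong (_+ h) moved ⟩
            i + t + d′ * k + h   ≡⟨ +-assoc (i + t) (d′ * k) h ⟩
            i + t + (d′ * k + h) ≡⟨ cong (i + t +_) (+-comm (d′ * k) h) ⟩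
            i + t + (h + d′ * k) ≡⟨ sym (+-assoc (i + t) h (d′ * k)) ⟩
            i + t + h + d′ * k   ≡⟨ cong (_+ d′ * k) (sym (swap i)) ⟩
            i + h + t + d′ * k   ∎
        agree : ∀ s → s < suc (b′ ∸ a′) → v (a′ + s) ≡ v (a′ + d′ + s)
        agree s (s≤s s≤) = subst₂ (λ p q → v p ≡ v q) (proj₂ (proj₂ hit))
          (trans (cong (_+ d′) (proj₂ (proj₂ hit))) (trans (+-assoc a′ s d′) (trans (cong (a′ +_) (+-comm s d′)) (sym (+-assoc a′ d′ s)))))
          (at (proj₁ hit) (proj₁ (proj₂ hit)))
          where
          -- Block `a′` is met at `i + h`; each later block up to `b′` is met at its first position.
          hits : ∀ s → s ≤ b′ ∸ a′ → ∃ λ t → t ≤ m ∸ E × (i + h + t) / k ≡ a′ + s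
          hits zero    _  = 0 , z≤n , trans (cong (_/ k) (+-identityʳ (i + h))) (sym (+-identityʳ a′))
          hits (suc s) s≤ = t , t≤ , trans (cong (_/ k) sum) (m*n/n≡m (a′ + suc s) k)
            where
            t = (a′ + suc s) * k ∸ (i + h)
            start : i + h ≤ (a′ + suc s) * k
            start = ≤-trans (<⇒≤ (<-block (i + h))) (*-monoˡ-≤ k (subst (suc a′ ≤_) (sym (+-suc a′ s)) (s≤s (m≤m+n a′ s))))
            sum : i + h + t ≡ (a′ + suc s) * k
            sum = m+[n∸m]≡n start
            t≤ : t ≤ m ∸ E
            t≤ = +-cancelˡ-≤ (i + h) _ _ (begin
              i + h + t           ≡⟨ sum ⟩
              (a′ + suc s) * k    ≤⟨ *-monoˡ-≤ k (subst (a′ + suc s ≤_) (m+[n∸m]≡n a′≤b′) (+-monoʳ-≤ a′ s≤)) ⟩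
              b′ * k              ≤⟨ m/n*n≤m (i + h + (m ∸ E)) k ⟩
              i + h + (m ∸ E)     ∎)
              where open ≤-Reasoning
          hit = hits s s≤

-- The words `u` and `w` and the finite checks on their morphisms.

-- The word of the last l decimal digits of m, so that leading zeros are not lost.
digits : ℕ → ℕ → List (Fin (suc n))
digits l m = go l m []
  where
  go : ℕ → ℕ → List (Fin (suc n)) → List (Fin (suc n))
  go zero    m acc = acc
  go (suc l) m acc = go l (m / 10) ((m % 10) mod _ ∷ acc)

-- f c is f 0 with c added to every letter modulo 6; f and g were found by computer search.
f : Fin 6 → List (Fin 6)
f zero                                  = digits 8 02512340
f (suc zero)                            = digits 8 13023451
f (suc (suc zero))                      = digits 8 24134502
f (suc (suc (suc zero)))                = digits 8 35245013
f (suc (suc (suc (suc zero))))          = digits 8 40350124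
f (suc (suc (suc (suc (suc zero)))))    = digits 8 51401235

g : Fin 6 → List (Fin 3)
g zero                                  = digits 46 2021211100021210102211100202221210100022211010
g (suc zero)                            = digits 46 2021211100221210100202221211100021210102211100
g (suc (suc zero))                      = digits 46 2021211102022121010022111010221211102221210100
g (suc (suc (suc zero)))                = digits 46 2021211101002121101022211102022121010002221100
g (suc (suc (suc (suc zero))))          = digits 46 2021211010222121102022211002121010202211101000
g (suc (suc (suc (suc (suc zero)))))    = digits 46 2021211010202221110202121010002212110202221100

triples : List (List (Fin 6))
triples = map (digits 3)
  ( 012 ∷ 013 ∷ 023 ∷ 024 ∷ 025 ∷ 035 ∷ 123 ∷ 124 ∷ 130 ∷ 134 ∷ 135 ∷ 140
  ∷ 234 ∷ 235 ∷ 240 ∷ 241 ∷ 245 ∷ 251 ∷ 302 ∷ 340 ∷ 345 ∷ 350 ∷ 351 ∷ 352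
  ∷ 401 ∷ 402 ∷ 403 ∷ 413 ∷ 450 ∷ 451 ∷ 501 ∷ 502 ∷ 512 ∷ 513 ∷ 514 ∷ 524 ∷ [])

f-length : ∀ c → length (f c) ≡ 8
f-length zero                               = refl
f-length (suc zero)                         = refl
f-length (suc (suc zero))                   = refl
f-length (suc (suc (suc zero)))             = refl
f-length (suc (suc (suc (suc zero))))       = refl
f-length (suc (suc (suc (suc (suc zero))))) = refl

g-length : ∀ c → length (g c) ≡ 46
g-length zero                               = refl
g-length (suc zero)                         = refl
g-length (suc (suc zero))                   = refl
g-length (suc (suc (suc zero)))             = refl
g-length (suc (suc (suc (suc zero))))       = refl
g-length (suc (suc (suc (suc (suc zero))))) = refl

-- The first argument is fuel; any value ≥ i gives the i-th letter.
fixedPoint : ℕ → ℕ → Fin 6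
fixedPoint fuel       zero      = zero
fixedPoint zero       (suc i)   = zero
fixedPoint (suc fuel) i@(suc _) = nth (f (fixedPoint fuel (i / 8))) (i % 8)

fixedPoint-fuel : ∀ p q i → i ≤ p → i ≤ q → fixedPoint p i ≡ fixedPoint q i
fixedPoint-fuel p       q       zero      _   _   = refl
fixedPoint-fuel (suc p) (suc q) i@(suc _) i≤p i≤q = cong (λ c → nth (f c) (i % 8))
  (fixedPoint-fuel p q (i / 8) (smaller i≤p) (smaller i≤q))
  where
  smaller : ∀ {r} → i ≤ suc r → i / 8 ≤ r
  smaller i≤r = ≤-pred (<-≤-trans (m/n<m i 8 (s≤s (s≤s z≤n))) i≤r)

u : ℕ → Fin 6
u i = fixedPoint i i

w : ℕ → Fin 3
w i = nth (g (u (i / 46))) (i % 46)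

u-letter : ∀ i → u i ≡ nth (f (u (i / 8))) (i % 8)
u-letter zero      = refl
u-letter i@(suc j) = cong (λ c → nth (f c) (i % 8))
  (fixedPoint-fuel j (i / 8) (i / 8) (≤-pred (m/n<m i 8 (s≤s (s≤s z≤n)))) ≤-refl)

module F  = Uniform 8 f triples
module G  = Uniform 46 g triples
module Fᵤ = F.Image u u (blocks-of-letters 8 f u u f-length u-letter)
module Gᵤ = G.Image u w (blocks-of-letters 46 g u w g-length (λ _ → refl))

_∈?_ : (s : List (Fin 6)) (ss : List (List (Fin 6))) → Dec (s ∈ ss)
_∈?_ = DecMembership._∈?_ (≡-dec _≟ᶠ_)

triplesTest : F.Test
triplesTest _ _ s = does (take 3 s ∈? triples)

f-triples : F.scan triplesTest ≡ true
f-triples = refl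

f-syncs : F.syncs (F.dictionary 6) 6 ≡ true
f-syncs = refl

-- One letter at a known offset suffices: the images are shifts of `f 0`, so at each offset they
-- show six different letters.
f-decodes : F.decodes 0 1 ≡ true
f-decodes = refl

-- `(d + 1) / 2` is the least `m` with `d ≤ 2m`. Repetitions too short to synchronise have `m ≤ 5`,
-- hence `d ≤ 10`.
f-repetitionFree : F.repetitionFree 10 (λ d → (d + 1) / 2) ≡ true
f-repetitionFree = refl

g-syncs : G.syncs (G.dictionary 27) 27 ≡ true
g-syncs = refl

-- The last nine letters of the six images differ pairwise, and so do the first twelve. The block
-- holding place 8, counted from 0, shows its last nine letters, its first twelve, or twenty
-- consecutive ones.
g-decodes : G.decodes 8 20 ≡ true
g-decodes = refl

-- `(d ∸ 2) / 2` is the least `m` with `d ≤ 2m + 3`. Below the synchronisation length 27 this gives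
-- `d ≤ 2 * 26 + 3 = 55`.
g-repetitionFree : G.repetitionFree 55 (λ d → 7 ⊔ ((d ∸ 2) / 2)) ≡ true
g-repetitionFree = refl

-- For `n > 0` the factor lies in the image of the triple at `n / 8 < n`, and `f-triples` says that
-- the list is closed under passing to such factors.
u-triples : ∀ n → win u n 3 ∈ triples
u-triples = <-rec (λ n → win u n 3 ∈ triples) step
  where
  step : ∀ n → (∀ {m} → m < n → win u m 3 ∈ triples) → win u n 3 ∈ triples
  step zero      ih = dec-sound (win u 0 3 ∈? triples) refl
  -- 17 is the window length `2k + 1` for `k = 8`.
  step n@(suc _) ih = subst (_∈ triples) (take-win u n (m≤m+n 3 14))
    (dec-sound (take 3 (win u n 17) ∈? triples)
      (Fᵤ.scan-sound-at triplesTest f-triples n (ih (m/n<m n 8 (s≤s (s≤s z≤n))))))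

module U = Fᵤ.Complete u-triples
module W = Gᵤ.Complete u-triples

-- Repetitions in `u` and `w`.

*-pos : ∀ {d} e k → 0 < d → d ≡ e * k → 0 < e
*-pos zero    k d>0 refl = d>0
*-pos (suc e) k _   _    = s≤s z≤n

-- Induction on the distance. As `E = 1`, the preimage of size `s` satisfies `m ≤ 8s`, so
-- `2s < d / 8` multiplies back to `2m < d` without loss.
u-repetition : ∀ d i m → 0 < m → 0 < d → win u i m ≡ win u (i + d) m → m + m < d
u-repetition = <-rec (λ d → ∀ i m → 0 < m → 0 < d → win u i m ≡ win u (i + d) m → m + m < d) step
  where
  step : ∀ d → (∀ {e} → e < d → ∀ i m → 0 < m → 0 < e → win u i m ≡ win u (i + e) m → m + m < e) →
    ∀ i m → 0 < m → 0 < d → win u i m ≡ win u (i + d) m → m + m < d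
  step d ih i m m>0 d>0 eq with 6 ≤? m
  ... | yes 6≤m = descend
    (U.desubstitute (F.dictionary 6) 6 0 1 f-syncs f-decodes (m≤m+n 6 11) (m≤m+n 1 16) z≤n 6≤m m>0 eq)
    where
    descend : U.Desubstituted d m 1 → m + m < d
    descend D = begin-strict
      m + m                     ≤⟨ +-mono-≤ m≤ m≤ ⟩
      size * 8 + size * 8       ≡⟨ sym (*-distribʳ-+ 8 size size) ⟩
      (size + size) * 8         <⟨ *-monoˡ-< 8 (ih d′<d position size size>0 d′>0 agreement) ⟩
      distance * 8              ≡⟨ sym d≡ ⟩
      d                         ∎
      where
      open ≤-Reasoning
      open U.Desubstituted D
      m≤ : m ≤ size * 8
      m≤ = ≤-pred (subst (m <_) (+-comm (size * 8) 1) m<)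
      d′>0 : 0 < distance
      d′>0 = *-pos distance 8 d>0 d≡
      d′<d : distance < d
      d′<d = subst (distance <_) (sym d≡)
        (subst (_< distance * 8) (*-identityʳ distance) (*-monoʳ-< distance {{>-nonZero d′>0}} (s≤s (s≤s z≤n))))
  ... | no  6≰m with d | m + m <? d
  ...   | _     | yes 2m<d = 2m<d
  ...   | suc d′ | no 2m≮d = contradiction eq
    (U.repetitionFree-sound 10 (λ d → (d + 1) / 2) f-repetitionFree (≤-trans d≤2m (+-mono-≤ m≤5 m≤5)) need≤m
      (≤-trans (+-monoˡ-≤ m d≤2m) (≤-trans (+-mono-≤ (+-mono-≤ m≤5 m≤5) m≤5) (m≤m+n 15 2))))
    where
    m≤5 : m ≤ 5
    m≤5 = ≤-pred (≰⇒> 6≰m)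
    d≤2m : suc d′ ≤ m + m
    d≤2m = ≮⇒≥ 2m≮d
    need≤m : (suc d′ + 1) / 2 ≤ m
    need≤m = ≤-pred (m<n*o⇒m/o<n (begin-strict
      suc d′ + 1     ≤⟨ +-monoˡ-≤ 1 d≤2m ⟩
      m + m + 1      <⟨ +-monoʳ-< (m + m) (s≤s (s≤s z≤n)) ⟩
      m + m + 2      ≡⟨ solve 1 (λ m → m :+ m :+ con 2 := (con 1 :+ m) :* con 2) refl m ⟩
      suc m * 2      ∎))
      where open ≤-Reasoning

-- A single desubstitution leads to `u`: there `m ≤ 46s + 19` and `2s + 1 ≤ d / 46`, so
-- `2m + 3 ≤ 92s + 41 < 46 (2s + 1) ≤ d`.
w-repetition : ∀ d i m → 7 ≤ m → 0 < d → win w i m ≡ win w (i + d) m → m + m + 3 < d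
w-repetition d i m 7≤m d>0 eq with 27 ≤? m
... | yes 27≤m = descend
  (W.desubstitute (G.dictionary 27) 27 8 20 g-syncs g-decodes
    (m≤m+n 27 66) (m≤m+n 20 73) (m≤m+n 8 38) 27≤m (≤-trans (m≤m+n 20 7) 27≤m) eq)
  where
  descend : W.Desubstituted d m 20 → m + m + 3 < d
  descend D = begin-strict
    m + m + 3                                     ≤⟨ +-monoˡ-≤ 3 (+-mono-≤ m≤ m≤) ⟩
    (size * 46 + 19) + (size * 46 + 19) + 3       ≡⟨ solve 1 (λ s → (s :* con 46 :+ con 19) :+ (s :* con 46 :+ con 19) :+ con 3 := (s :+ s) :* con 46 :+ con 41) refl size ⟩
    (size + size) * 46 + 41                       <⟨ +-monoʳ-< ((size + size) * 46) (m≤m+n 42 4) ⟩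
    (size + size) * 46 + 46                       ≡⟨ +-comm ((size + size) * 46) 46 ⟩
    suc (size + size) * 46                        ≤⟨ *-monoˡ-≤ 46 (u-repetition distance position size size>0 (*-pos distance 46 d>0 d≡) agreement) ⟩
    distance * 46                                 ≡⟨ sym d≡ ⟩
    d                                             ∎
    where
    open ≤-Reasoning
    open W.Desubstituted D
    m≤ : m ≤ size * 46 + 19
    m≤ = ≤-pred (subst (m <_) (+-suc (size * 46) 19) m<)
... | no 27≰m with d | m + m + 3 <? d
...   | _     | yes far = far
...   | suc d′ | no near = contradiction eq
    (W.repetitionFree-sound 55 (λ d → 7 ⊔ ((d ∸ 2) / 2)) g-repetitionFree
      (≤-trans d≤ bound) (⊔-lub 7≤m need≤m)
      (≤-trans (+-mono-≤ (≤-trans d≤ bound) m≤26) (m≤m+n 81 12)))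
  where
  m≤26 : m ≤ 26
  m≤26 = ≤-pred (≰⇒> 27≰m)
  d≤ : suc d′ ≤ m + m + 3
  d≤ = ≮⇒≥ near
  bound : m + m + 3 ≤ 55
  bound = +-monoˡ-≤ 3 (+-mono-≤ m≤26 m≤26)
  need≤m : (suc d′ ∸ 2) / 2 ≤ m
  need≤m = ≤-pred (m<n*o⇒m/o<n (begin-strict
    suc d′ ∸ 2        ≤⟨ ∸-monoˡ-≤ 2 d≤ ⟩
    m + m + 3 ∸ 2     ≡⟨ +-∸-assoc (m + m) {3} {2} (s≤s (s≤s z≤n)) ⟩
    m + m + 1         <⟨ +-monoʳ-< (m + m) (s≤s (s≤s z≤n)) ⟩
    m + m + 2         ≡⟨ solve 1 (λ m → m :+ m :+ con 2 := (con 1 :+ m) :* con 2) refl m ⟩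
    suc m * 2         ∎))
    where open ≤-Reasoning

-- Length bounds for the images of x and y.

At : List (Fin 3) → ℕ → Set
At s i = win w i (length s) ≡ s

factor-at : ∀ s → Factor s w → ∃ (At s)
factor-at s (i , e) = i , go s i e
  where
  go : ∀ s i → ((j : Fin (length s)) → w (i + toℕ j) ≡ lookup s j) → At s i
  go []      i e = refl
  go (c ∷ s) i e = cong₂ _∷_ (subst (λ j → w j ≡ c) (+-identityʳ i) (e zero))
    (go s (suc i) (λ j → subst (λ l → w l ≡ lookup s j) (+-suc i (toℕ j)) (e (suc j))))

at-++ : ∀ s t {i} → At (s ++ t) i → At s i × At t (i + length s)
at-++ []      t {i} e = refl , subst (At t) (sym (+-identityʳ i)) e
at-++ (c ∷ s) t {i} e with ∷-injective e
... | e₁ , e₂ with at-++ s t e₂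
...   | p , q = cong₂ _∷_ e₁ p , subst (At t) (sym (+-suc i (length s))) q

-- The two copies of `s` are at distance at most `2 * length s + 3`, which `w-repetition` excludes
-- once `s` has seven letters.
border-short : ∀ s t r i → At (s ++ t ++ r ++ s) i → length t + length r ≤ length s + 3 → length s ≤ 6
border-short s t r i e tr≤ with 7 ≤? length s
... | no 7≰s  = ≤-pred (≰⇒> 7≰s)
... | yes 7≤s = contradiction
  (w-repetition (length s + (length t + length r)) i (length s) 7≤s
    (≤-trans (≤-trans (s≤s z≤n) 7≤s) (m≤m+n _ _)) same) (≤⇒≯ d≤)
  where
  first : At s i
  first = proj₁ (at-++ s (t ++ r ++ s) e)
  last : At s (i + length s + length t + length r)
  last = proj₂ (at-++ r s (proj₂ (at-++ t (r ++ s) (proj₂ (at-++ s (t ++ r ++ s) e)))))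
  same : win w i (length s) ≡ win w (i + (length s + (length t + length r))) (length s)
  same = trans first (sym (subst (At s) (trans (+-assoc (i + length s) (length t) (length r)) (+-assoc i (length s) _)) last))
  d≤ : length s + (length t + length r) ≤ length s + length s + 3
  d≤ = ≤-trans (+-monoʳ-≤ (length s) tr≤) (≤-reflexive (sym (+-assoc (length s) (length s) 3)))

-- The longer of `s` and `t` is bounded through the fragment it borders, and it bounds the other.
-- Taking `r′` to be z or its reversal serves both formulas.
both-short : ∀ s t r r′ i j → At (s ++ t ++ r ++ s) i → At (t ++ r′ ++ s ++ t) j →
  length r ≤ 3 → length r′ ≤ 3 → length s ≤ 6 × length t ≤ 6
both-short s t r r′ i j e e′ r≤ r′≤ with ≤-total (length t) (length s)
... | inj₁ t≤s = let s≤ = border-short s t r i e (+-mono-≤ t≤s r≤) in s≤ , ≤-trans t≤s s≤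
... | inj₂ s≤t = let t≤ = border-short t r′ s j e′ (subst (_≤ length t + 3) (+-comm (length s) (length r′)) (+-mono-≤ s≤t r′≤)) in ≤-trans s≤t t≤ , t≤

-- Exclusion of the remaining short occurrences.

take-length-++ : (s t : List A) → take (length s) (s ++ t) ≡ s
take-length-++ []      t = refl
take-length-++ (c ∷ s) t = cong (c ∷_) (take-length-++ s t)

drop-length-++ : (s t : List A) → drop (length s) (s ++ t) ≡ t
drop-length-++ []      t = refl
drop-length-++ (c ∷ s) t = drop-length-++ s t

length-four : (s t r : List A) → length (s ++ t ++ r ++ s) ≡ length s + (length t + (length r + length s))
length-four s t r = trans (length-++ s) (cong (length s +_) (trans (length-++ t) (cong (length t +_) (length-++ r))))

four-≤ : (s t r : List A) → length s ≤ 6 → length t ≤ 6 → length r ≤ 3 → length (t ++ r ++ s ++ t) ≤ 27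
four-≤ s t r s≤ t≤ r≤ = ≤-trans (≤-reflexive (length-four t r s)) (≤-trans (+-mono-≤ t≤ (+-mono-≤ r≤ (+-mono-≤ s≤ t≤))) (m≤m+n 21 6))

-- For the dictionary of length 27 this holds for every factor of `w` of length at most 27, so its
-- failure shows that such a word is not a factor.
known : Trie 3 → List (Fin 3) → Bool
known T s = nonempty (subtrie s T)

-- With `s`, `t`, `r` as x, y, z, the first disjunct covers the fragments of `F₁` other than xyzx,
-- the second the one of `F₂`.
clash : Trie 3 → List (Fin 3) → List (Fin 3) → List (Fin 3) → Bool
clash T s t r = (known T (reverse r) ∧ known T (t ++ r ++ s ++ t)) ∨ known T (t ++ reverse r ++ s ++ t)

clashFree : Trie 3 → List (Fin 3) → List (Fin 3) → List (Fin 3) → List (Fin 3) → Bool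
-- In the scan `rest` is longer than `s`, so `comparable` means that the window begins with xyzx.
clashFree T s t r rest = not (comparable s rest ∧ clash T s t r)

clashFreeAt : Trie 3 → List (Fin 3) → ℕ → ℕ → ℕ → Bool
clashFreeAt T s a b c = clashFree T (take a s) (take b (drop a s)) (take c (drop b (drop a s))) (drop c (drop b (drop a s)))

knownTest : Trie 3 → G.Test
knownTest T _ _ s = known T (take 27 s)

reversalTest : Trie 3 → G.Test
reversalTest T _ _ s = not (known T (reverse (take 4 s)))

formulaTest : Trie 3 → G.Test
-- Lengths 1 to 6 for x and y, and 1 to 3 for z.
formulaTest T _ _ s = allBelow 6 λ a → allBelow 6 λ b → allBelow 3 λ c → clashFreeAt T s (suc a) (suc b) (suc c)

g-known : G.scan (knownTest (G.dictionary 27)) ≡ true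
g-known = refl

g-reversal : G.scan (reversalTest (G.dictionary 27)) ≡ true
g-reversal = refl

g-formula : G.scan (formulaTest (G.dictionary 27)) ≡ true
g-formula = refl

clashFreeAt-++ : ∀ T s t r rest → clashFreeAt T (s ++ t ++ r ++ rest) (length s) (length t) (length r) ≡ clashFree T s t r rest
clashFreeAt-++ T s t r rest
  rewrite take-length-++ s (t ++ r ++ rest) | drop-length-++ s (t ++ r ++ rest)
        | take-length-++ t (r ++ rest) | drop-length-++ t (r ++ rest)
        | take-length-++ r rest | drop-length-++ r rest = refl

-- T is kept abstract so that the dictionary is never unfolded outside the tests.
module Avoidance (T : Trie 3) (kn : G.scan (knownTest T) ≡ true) (rv : G.scan (reversalTest T) ≡ true)
  (fm : G.scan (formulaTest T) ≡ true) where

  known-at : ∀ s i → At s i → length s ≤ 27 → known T s ≡ true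
  known-at s i e s≤ = nonempty-++ s (win w (i + length s) (27 ∸ length s)) T
    (subst (λ t → known T t ≡ true) split (W.scan-sound (knownTest T) kn i))
    where
    split : take 27 (win w i 93) ≡ s ++ win w (i + length s) (27 ∸ length s)
    split = trans (take-win w i (m≤m+n 27 66)) (trans (cong (win w i) (sym (m+[n∸m]≡n s≤)))
      (trans (win-+ w i (length s) _) (cong (_++ win w (i + length s) (27 ∸ length s)) e)))

  -- If `r` has four letters or more, the reversal of its prefix of length 4 is a suffix of
  -- `reverse r`, and `rv` forbids that reversal in `w`.
  reversible-short : ∀ r i j → At r i → At (reverse r) j → length r ≤ 3
  reversible-short []              i j e e′ = z≤n
  reversible-short (_ ∷ [])        i j e e′ = s≤s z≤n
  reversible-short (_ ∷ _ ∷ [])    i j e e′ = s≤s (s≤s z≤n)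
  reversible-short (_ ∷ _ ∷ _ ∷ []) i j e e′ = s≤s (s≤s (s≤s z≤n))
  reversible-short (c₁ ∷ c₂ ∷ c₃ ∷ c₄ ∷ r) i j e e′ = contradiction
    (known-at (reverse s) (j + length (reverse r)) (proj₂ (at-++ (reverse r) (reverse s) (subst (λ t → At t j) (reverse-++ s r) e′))) (m≤m+n 4 23))
    (λ k → not-true (W.scan-sound (reversalTest T) rv i) (trans (cong (λ t → known T (reverse t)) prefix) k))
    where
    s = c₁ ∷ c₂ ∷ c₃ ∷ c₄ ∷ []
    prefix : take 4 (win w i 93) ≡ s
    prefix = trans (take-win w i (m≤m+n 4 89)) (proj₁ (at-++ s r e))

  no-clash : ∀ s t r i → s ≢ [] → t ≢ [] → r ≢ [] → At (s ++ t ++ r ++ s) i →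
    length s ≤ 6 → length t ≤ 6 → length r ≤ 3 → clash T s t r ≡ true → ⊥
  no-clash []          t           r           i s≢ t≢ r≢ e s≤ t≤ r≤ c = s≢ refl
  no-clash (_ ∷ _)     []          r           i s≢ t≢ r≢ e s≤ t≤ r≤ c = t≢ refl
  no-clash (_ ∷ _)     (_ ∷ _)     []          i s≢ t≢ r≢ e s≤ t≤ r≤ c = r≢ refl
  -- Splitting off first letters turns each length into a successor, the form over which
  -- `formulaTest` ranges.
  no-clash s@(_ ∷ s′)  t@(_ ∷ t′)  r@(_ ∷ r′)  i s≢ t≢ r≢ e s≤ t≤ r≤ c =
    not-true free (cong₂ _∧_ (comparable-++ s rest) c)
    where
    l : ℕ
    l = length (s ++ t ++ r ++ s)
    rest : List (Fin 3)
    rest = win w (i + l) (93 ∸ l)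
    l≤ : l ≤ 93
    l≤ = ≤-trans (≤-reflexive (length-four s t r)) (≤-trans (+-mono-≤ s≤ (+-mono-≤ t≤ (+-mono-≤ r≤ s≤))) (m≤m+n 21 72))
    split : win w i 93 ≡ s ++ t ++ r ++ s ++ rest
    split = begin
      win w i 93                          ≡⟨ cong (win w i) (sym (m+[n∸m]≡n l≤)) ⟩
      win w i (l + (93 ∸ l))              ≡⟨ win-+ w i l (93 ∸ l) ⟩
      win w i l ++ rest                   ≡⟨ cong (_++ rest) e ⟩
      (s ++ t ++ r ++ s) ++ rest          ≡⟨ ++-assoc s (t ++ r ++ s) rest ⟩
      s ++ (t ++ r ++ s) ++ rest          ≡⟨ cong (s ++_) (++-assoc t (r ++ s) rest) ⟩
      s ++ t ++ (r ++ s) ++ rest          ≡⟨ cong (λ q → s ++ t ++ q) (++-assoc r s rest) ⟩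
      s ++ t ++ r ++ s ++ rest            ∎
      where open ≡-Reasoning
    scanned : clashFreeAt T (win w i 93) (length s) (length t) (length r) ≡ true
    scanned = allBelow-sound (λ c → clashFreeAt T (win w i 93) (length s) (length t) (suc c))
      (allBelow-sound (λ b → allBelow 3 λ c → clashFreeAt T (win w i 93) (length s) (suc b) (suc c))
        (allBelow-sound (λ a → allBelow 6 λ b → allBelow 3 λ c → clashFreeAt T (win w i 93) (suc a) (suc b) (suc c))
          (W.scan-sound (formulaTest T) fm i) s≤) t≤) r≤
    free : clashFree T s t r (s ++ rest) ≡ true
    free = trans (sym (clashFreeAt-++ T s t r (s ++ rest)))
      (trans (cong (λ q → clashFreeAt T q (length s) (length t) (length r)) (sym split)) scanned)

  module _ (h : Fin 3 → List (Fin 3)) (h≢ : (c : Fin 3) → h c ≢ []) where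

    X Y Z : List (Fin 3)
    X = h zero
    Y = h (suc zero)
    Z = h (suc (suc zero))

    no-F₁ : ∀ i j l → At (X ++ Y ++ Z ++ X) i → At (Y ++ Z ++ X ++ Y) j → At (reverse Z) l → ⊥
    no-F₁ i j l e e′ e″ = no-clash X Y Z i (h≢ _) (h≢ _) (h≢ _) e X≤ Y≤ Z≤
      (cong (_∨ known T (Y ++ reverse Z ++ X ++ Y)) (cong₂ _∧_
        (known-at (reverse Z) l e″ (≤-trans (≤-reflexive (length-reverse Z)) (≤-trans Z≤ (m≤m+n 3 24))))
        (known-at (Y ++ Z ++ X ++ Y) j e′ (four-≤ X Y Z X≤ Y≤ Z≤))))
      where
      -- z is found inside yzxy, its reversal as the third fragment.
      Z≤ = reversible-short Z _ l (proj₁ (at-++ Z (X ++ Y) (proj₂ (at-++ Y (Z ++ X ++ Y) e′)))) e″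
      XY≤ = both-short X Y Z Z i j e e′ Z≤ Z≤
      X≤ = proj₁ XY≤
      Y≤ = proj₂ XY≤

    no-F₂ : ∀ i j → At (X ++ Y ++ Z ++ X) i → At (Y ++ reverse Z ++ X ++ Y) j → ⊥
    no-F₂ i j e e′ = no-clash X Y Z i (h≢ _) (h≢ _) (h≢ _) e X≤ Y≤ Z≤
      (trans (cong (known T (reverse Z) ∧ known T (Y ++ Z ++ X ++ Y) ∨_)
        (known-at (Y ++ reverse Z ++ X ++ Y) j e′ (four-≤ X Y (reverse Z) X≤ Y≤ Zᴿ≤))) (∨-zeroʳ _))
      where
      -- z is found inside the first fragment, its reversal inside the second.
      Z≤ = reversible-short Z _ _
        (proj₁ (at-++ Z X (proj₂ (at-++ Y (Z ++ X) (proj₂ (at-++ X (Y ++ Z ++ X) e))))))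
        (proj₁ (at-++ (reverse Z) (X ++ Y) (proj₂ (at-++ Y (reverse Z ++ X ++ Y) e′))))
      Zᴿ≤ = ≤-trans (≤-reflexive (length-reverse Z)) Z≤
      XY≤ = both-short X Y Z (reverse Z) i j e e′ Z≤ Zᴿ≤
      X≤ = proj₁ XY≤
      Y≤ = proj₂ XY≤

-- Avoidance of the two formulas.

module Avoids-w = Avoidance (G.dictionary 27) g-known g-reversal g-formula

-- `concatMap` leaves a trailing `++ []` on each image, which is removed here.
factor-four : ∀ s t r q → Factor (s ++ t ++ r ++ q ++ []) w → ∃ (At (s ++ t ++ r ++ q))
factor-four s t r q p = factor-at _ (subst (λ q′ → Factor (s ++ t ++ r ++ q′) w) (++-identityʳ q) p)

avoids-F₁ : Avoids w F₁
avoids-F₁ (h , h≢ , p₁ ∷ p₂ ∷ p₃ ∷ []) =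
  let i , e₁ = factor-four (h zero) (h (suc zero)) (h (suc (suc zero))) (h zero) p₁
      j , e₂ = factor-four (h (suc zero)) (h (suc (suc zero))) (h zero) (h (suc zero)) p₂
      l , e₃ = factor-at (reverse (h (suc (suc zero)))) (subst (λ s → Factor s w) (++-identityʳ (reverse (h (suc (suc zero))))) p₃)
  in Avoids-w.no-F₁ h h≢ i j l e₁ e₂ e₃

avoids-F₂ : Avoids w F₂
avoids-F₂ (h , h≢ , p₁ ∷ p₂ ∷ []) =
  let i , e₁ = factor-four (h zero) (h (suc zero)) (h (suc (suc zero))) (h zero) p₁
      j , e₂ = factor-four (h (suc zero)) (reverse (h (suc (suc zero)))) (h zero) (h (suc zero)) p₂
  in Avoids-w.no-F₂ h h≢ i j e₁ e₂

theorem3 : Σ (InfWord (Fin 3)) λ w → Avoids w F₁ × Avoids w F₂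
theorem3 = w , avoids-F₁ , avoids-F₂
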